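{- Let $G$ be a connected graph of order $n$, minimum degree $\delta$ and maximum degree $\Delta$. If $\Delta > \frac{n}{2}-1$, then \[ \pi(G) \leq \frac{3(n-\Delta)^2}{2(n-1)(\delta+1)} + \frac{13}{2}. \] If $\Delta \leq \frac{n}{2}-1$, then \[ \pi(G) \leq \frac{3(n^2-2\Delta^2)}{4(n-1)(\delta+1)} + \frac{35}{4}. \]
   Context: For a connected graph $G$ of order $n \ge 2$ and a vertex $v$, the average distance of $v$ is $\overline{\sigma}(v,G) = \frac{1}{n-1}\sum_{u \in V(G)} d(v,u)$, where $d$ is the shortest-path distance. The proximity $\pi(G)$ is the minimum of $\overline{\sigma}(v,G)$ over all vertices $v$ of $G$. -}

module Defs where

open import Data.Nat as ℕ using (ℕ; zero; suc; _≤_; _+_; _*_)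
open import Data.Fin using (Fin; zero)
open import Data.List using (List; map; foldr; length; filter)
open import Data.Nat.ListAction using (sum)
open import Data.List.Base using (allFin)
open import Data.Product using (Σ; ∃; _×_)
open import Relation.Nullary using (¬_)
open import Relation.Binary using (Decidable)
open import Data.Integer using (ℤ; +_)
open import Data.Rational using (ℚ; _/_; _⊓_)

record Graph (n : ℕ) : Set₁ where
  field
    Adj   : Fin n → Fin n → Set
    adj?  : Decidable Adj
    sym   : ∀ {u v} → Adj u v → Adj v u
    irrefl : ∀ {u} → ¬ Adj u u
open Graph public

data Walk {n : ℕ} (G : Graph n) : Fin n → Fin n → ℕ → Set where
  []  : ∀ {u} → Walk G u u 0
  _∷_ : ∀ {u w v k} → Adj G u w → Walk G w v k → Walk G u v (suc k)

Connected : ∀ {n} → Graph n → Set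
Connected {n} G = ∀ (u v : Fin n) → ∃ λ k → Walk G u v k

IsDistance : ∀ {n} → Graph n → (Fin n → Fin n → ℕ) → Set
IsDistance {n} G d =
  ∀ (u v : Fin n) → Walk G u v (d u v) × (∀ m → Walk G u v m → d u v ≤ m)

degree : ∀ {n} → Graph n → Fin n → ℕ
degree {n} G v = length (filter (adj? G v) (allFin n))

maxDegree : ∀ {n} → Graph n → ℕ
maxDegree {n} G = foldr ℕ._⊔_ 0 (map (degree G) (allFin n))

minDegree : ∀ {k} → Graph (suc k) → ℕ
minDegree {k} G = foldr ℕ._⊓_ (degree G zero) (map (degree G) (allFin (suc k)))

-- average distance of v in a graph of order n = k + 2 (so n - 1 = k + 1)
avgDist : ∀ {k} → (Fin (suc (suc k)) → Fin (suc (suc k)) → ℕ) → Fin (suc (suc k)) → ℚ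
avgDist {k} d v = (+ sum (map (d v) (allFin (suc (suc k))))) / suc k

proximity : ∀ {k} → (Fin (suc (suc k)) → Fin (suc (suc k)) → ℕ) → ℚ
proximity {k} d = foldr _⊓_ (avgDist d zero) (map (avgDist d) (allFin (suc (suc k))))

{-# OPTIONS --safe #-}

-- Let z be a vertex of maximum degree, and grow from z a maximal set A of
-- vertices pairwise at distance at least 3, each new one at distance 3 from an
-- old one.  This makes A a tree whose edges have length 3 in G.  Assign every
-- vertex of G to a member of A at distance at most 2, so that the closed
-- neighbourhood of a ∈ A is assigned to a; then a gets weight at least
-- s = δ + 1, z gets weight at least h = Δ + 1, and the weights add up to n.  The
-- distances from c ∈ A add up to at most 3 D + 2 n, with D the weighted sum of
-- the depths in the tree rerooted at c.  A branch of weight W contributes at most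
-- (W² + s W) / 2s to D, and h² − s h less in the numerator if z lies in it.  The
-- first bound is the choice c = z; for the second c is a weighted centroid, all
-- branches of which weigh at most n / 2.

module Submission where

open import Defs
open import Data.Nat using (ℕ; suc)
import Data.Nat as ℕ
import Data.Nat.Properties as ℕ
import Data.Integer.Properties as ℤ
import Data.Rational.Properties as ℚ
open import Data.Nat.ListAction using (sum)
open import Data.Product using (_×_; ∃; ∃₂; _,_; proj₁; proj₂)
open import Data.Sum using (_⊎_; inj₁; inj₂)
open import Data.Unit using (⊤; tt)
open import Data.Fin using (Fin; zero; suc)
open import Data.Fin.Properties using (_≟_; injective⇒≤; all?; ¬∀⟶∃¬)
open import Data.List using (List; []; _∷_; map; length; filter; allFin; lookup; foldr; tabulate)
open import Data.List.Properties using (length-tabulate)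
open import Data.List.Membership.Propositional using (_∈_; find; lose)
open import Data.List.Membership.Propositional.Properties using (∈-allFin; ∈-lookup)
open import Data.List.Relation.Unary.Any as Any using (Any; here; there)
open import Data.List.Relation.Unary.All as All using (All; []; _∷_)
open import Data.List.Relation.Unary.All.Properties using (¬Any⇒All¬)
open import Data.List.Relation.Unary.AllPairs as AllPairs using (AllPairs; []; _∷_)
open import Data.List.Relation.Unary.Unique.Propositional using (Unique)
open import Function using (id)
open import Relation.Nullary using (¬_; Dec; yes; no; contradiction)
open import Relation.Binary.Definitions using (Symmetric)
open import Relation.Binary.PropositionalEquality using (_≡_; _≢_; refl; trans; cong; cong₂; subst; module ≡-Reasoning) renaming (sym to ≡-sym)

-- Weighted forests: grafting, centroids and depth sums.

module Forests where

  open import Data.Nat using (zero; _+_; _*_; _≤_; z≤n; _≤?_)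
  open import Data.Nat.Properties hiding (_≟_)
  open import Data.Nat.Tactic.RingSolver using (solve-∀)

  -- First-child/next-sibling encoding: a root label, its children, its siblings.
  data Forest (X : Set) : Set where
    ∅    : Forest X
    node : X → Forest X → Forest X → Forest X

  -- A proof is a position in the forest, which `insert` takes as the place to graft.
  data _∈ᶠ_ {X : Set} (a : X) : Forest X → Set where
    here    : ∀ {cs ss} → a ∈ᶠ node a cs ss
    child   : ∀ {x cs ss} → a ∈ᶠ cs → a ∈ᶠ node x cs ss
    sibling : ∀ {x cs ss} → a ∈ᶠ ss → a ∈ᶠ node x cs ss

  module _ {X : Set} where

    total : (X → ℕ) → Forest X → ℕ
    total g ∅             = 0
    total g (node x cs ss) = g x + total g cs + total g ss

    -- The roots have depth 1: the forest hangs below an extra vertex.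
    depthSum : (X → ℕ) → Forest X → ℕ
    depthSum w ∅              = 0
    depthSum w (node x cs ss) = (w x + total w cs) + depthSum w cs + depthSum w ss

    Linked : (X → X → Set) → X → Forest X → Set
    Linked R x ∅              = ⊤
    Linked R x (node y cs ss) = R x y × Linked R y cs × Linked R x ss

    -- The balance condition of a centroid, with `n` the total weight: only the branches at the top
    -- level are tested.
    Capped : (X → ℕ) → ℕ → Forest X → Set
    Capped w n ∅              = ⊤
    Capped w n (node y cs ss) = 2 * (w y + total w cs) ≤ n × Capped w n ss

    infixr 5 _++ᶠ_
    _++ᶠ_ : Forest X → Forest X → Forest X
    ∅             ++ᶠ gs = gs
    node x cs ss ++ᶠ gs = node x cs (ss ++ᶠ gs)

    total-++ᶠ : ∀ g fs gs → total g (fs ++ᶠ gs) ≡ total g fs + total g gs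
    total-++ᶠ g ∅              gs = refl
    total-++ᶠ g (node x cs ss) gs =
      trans (cong (g x + total g cs +_) (total-++ᶠ g ss gs)) (≡-sym (+-assoc (g x + total g cs) _ _))

    Linked-++ᶠ : ∀ {R x} fs {gs} → Linked R x fs → Linked R x gs → Linked R x (fs ++ᶠ gs)
    Linked-++ᶠ ∅              _              lg = lg
    Linked-++ᶠ (node y cs ss) (r , lc , ls) lg = r , lc , Linked-++ᶠ ss ls lg

    insert : ∀ {a F} → a ∈ᶠ F → X → Forest X
    insert {F = node x cs ss} here        y = node x (node y ∅ cs) ss
    insert {F = node x cs ss} (child p)   y = node x (insert p y) ss
    insert {F = node x cs ss} (sibling p) y = node x cs (insert p y)

    total-insert : ∀ g {a F} (p : a ∈ᶠ F) y → total g (insert p y) ≡ g y + total g F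
    total-insert g {F = node x cs ss} here y = lemma (g x) (g y) (total g cs) (total g ss)
      where
      lemma : ∀ x y c s → x + (y + 0 + c) + s ≡ y + (x + c + s)
      lemma = solve-∀
    total-insert g {F = node x cs ss} (child p) y =
      trans (cong (λ t → g x + t + total g ss) (total-insert g p y))
            (lemma (g x) (g y) (total g cs) (total g ss))
      where
      lemma : ∀ x y c s → x + (y + c) + s ≡ y + (x + c + s)
      lemma = solve-∀
    total-insert g {F = node x cs ss} (sibling p) y =
      trans (cong (g x + total g cs +_) (total-insert g p y))
            (lemma (g x) (g y) (total g cs) (total g ss))
      where
      lemma : ∀ x y c s → x + c + (y + s) ≡ y + (x + c + s)
      lemma = solve-∀

    Linked-insert : ∀ {R x a F} (p : a ∈ᶠ F) {y} → Linked R x F → R a y → Linked R x (insert p y)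
    Linked-insert here        (r , lc , ls) ay = r , (ay , tt , lc) , ls
    Linked-insert (child p)   (r , lc , ls) ay = r , Linked-insert p lc ay , ls
    Linked-insert (sibling p) (r , lc , ls) ay = r , lc , Linked-insert p ls ay

    ∈ᶠ-insert-new : ∀ {a F} (p : a ∈ᶠ F) y → y ∈ᶠ insert p y
    ∈ᶠ-insert-new here        y = child here
    ∈ᶠ-insert-new (child p)   y = child (∈ᶠ-insert-new p y)
    ∈ᶠ-insert-new (sibling p) y = sibling (∈ᶠ-insert-new p y)

    ∈ᶠ-insert-old : ∀ {a b F} (p : a ∈ᶠ F) y → b ∈ᶠ F → b ∈ᶠ insert p y
    ∈ᶠ-insert-old here        y here        = here
    -- `y` becomes the first child of `a`, so the former children of `a` are now siblings of `y`.
    ∈ᶠ-insert-old here        y (child q)   = child (sibling q)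
    ∈ᶠ-insert-old here        y (sibling q) = sibling q
    ∈ᶠ-insert-old (child p)   y here        = here
    ∈ᶠ-insert-old (child p)   y (child q)   = child (∈ᶠ-insert-old p y q)
    ∈ᶠ-insert-old (child p)   y (sibling q) = sibling q
    ∈ᶠ-insert-old (sibling p) y here        = here
    ∈ᶠ-insert-old (sibling p) y (child q)   = child q
    ∈ᶠ-insert-old (sibling p) y (sibling q) = sibling (∈ᶠ-insert-old p y q)

    -- Walk towards the heavy child until there is none: `cs` holds the children
    -- of `x` still to be inspected, `us` the light branches at `x` (the one
    -- containing the former root among them).
    centroid : ∀ {R} → Symmetric R → ∀ w n x cs us →
      Linked R x cs → Linked R x us → Capped w n us →
      w x + total w cs + total w us ≡ n →
      ∃₂ λ c F → Linked R c F × Capped w n F ×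
                 (∀ g → g c + total g F ≡ g x + total g cs + total g us)
    centroid R-sym w n x ∅ us _ lu cu _ =
      x , us , lu , cu , λ g → cong (_+ total g us) (≡-sym (+-identityʳ (g x)))
    centroid R-sym w n x (node y ds ss) us (r , ld , ls) lu cu eq
      with 2 * (w y + total w ds) ≤? n
    ... | yes light =
      let c , F , lF , cF , same =
            centroid R-sym w n x ss (node y ds us) ls (r , ld , lu) (light , cu)
              (trans (shift (w x) (w y + total w ds) (total w ss) (total w us)) eq)
      in c , F , lF , cF , λ g →
           trans (same g) (shift (g x) (g y + total g ds) (total g ss) (total g us))
      where
      shift : ∀ x t s u → x + s + (t + u) ≡ x + (t + s) + u
      shift = solve-∀
    -- The walk steps down to `y`, and `x` with its remaining branches becomes a single branch at
    -- `y`. The recursion is on `ds`, a part of the uninspected children, so it ends although the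
    -- light branches change.
    ... | no heavy =
      let c , F , lF , cF , same =
            centroid R-sym w n y ds (node x (us ++ᶠ ss) ∅) ld
              (R-sym r , Linked-++ᶠ us lu ls , tt) (light , tt) (trans (reroot w) eq)
      in c , F , lF , cF , λ g → trans (same g) (reroot g)
      where
      lemma : ∀ y d x u s → y + d + (x + (u + s) + 0) ≡ x + (y + d + s) + u
      lemma = solve-∀

      reroot : ∀ g → g y + total g ds + total g (node x (us ++ᶠ ss) ∅)
                   ≡ g x + total g (node y ds ss) + total g us
      reroot g = trans (cong (λ t → g y + total g ds + (g x + t + 0)) (total-++ᶠ g us ss))
                       (lemma (g y) (total g ds) (g x) (total g us) (total g ss))

      T = w y + total w ds
      U = w x + total w (us ++ᶠ ss)

      T+U≡n : T + U ≡ n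
      T+U≡n = trans (cong (T +_) (≡-sym (+-identityʳ U))) (trans (reroot w) eq)

      -- The tree splits into parts of weights `T` and `U`; as `T` exceeds half of `n`, `U` cannot.
      light : 2 * U ≤ n
      light = +-cancelˡ-≤ n (2 * U) n (begin
        n + 2 * U      ≤⟨ +-monoˡ-≤ (2 * U) (<⇒≤ (≰⇒> heavy)) ⟩
        2 * T + 2 * U  ≡⟨ ≡-sym (*-distribˡ-+ 2 T U) ⟩
        2 * (T + U)    ≡⟨ cong (2 *_) T+U≡n ⟩
        2 * n          ≡⟨ cong (n +_) (+-identityʳ n) ⟩
        n + n          ∎)
        where open ≤-Reasoning

    -- Quadratic bounds on depth sums.

    module _ (w r : X → ℕ) (s : ℕ) where

      -- `r x` is a saving reserved at `x`, paid for by the slack in s w ≤ w².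
      Heavy : X → Set
      Heavy x = s ≤ w x × s * w x + r x ≤ w x * w x

      -- Induction by expanding the square of `v + C + S`. Lowering the children by one level costs
      -- 2 s C, which the cross term 2 v C pays since s ≤ v; v² pays s v and the saving. A path of
      -- vertices of weight `s` without savings gives equality.
      depthSum-bound : ∀ {R} → (∀ {x y} → R x y → Heavy y) → ∀ x F → Linked R x F →
        2 * s * depthSum w F + total r F ≤ total w F * total w F + s * total w F
      depthSum-bound good x ∅ _ rewrite *-zeroʳ (2 * s) = z≤n
      depthSum-bound good x (node y cs ss) (xy , lc , ls) = begin
        2 * s * (v + C + D₁ + D₂) + (r y + total r cs + total r ss)
          ≡⟨ split s v C D₁ D₂ (r y) (total r cs) (total r ss) ⟩
        (2 * s * D₁ + total r cs) + (2 * s * D₂ + total r ss) + (s * v + r y) + 2 * C * s + s * v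
          ≤⟨ +-monoˡ-≤ (s * v) (+-mono-≤ (+-mono-≤ (+-mono-≤
               (depthSum-bound good y cs lc) (depthSum-bound good x ss ls))
               (proj₂ (good xy))) (*-monoʳ-≤ (2 * C) (proj₁ (good xy)))) ⟩
        (C * C + s * C) + (S * S + s * S) + v * v + 2 * C * v + s * v
          -- The cross terms between the first branch and its siblings are surplus.
          ≤⟨ m≤m+n _ (2 * v * S + 2 * C * S) ⟩
        (C * C + s * C) + (S * S + s * S) + v * v + 2 * C * v + s * v + (2 * v * S + 2 * C * S)
          ≡⟨ gather s v C S ⟩
        (v + C + S) * (v + C + S) + s * (v + C + S) ∎
        where
        open ≤-Reasoning
        v = w y
        C = total w cs
        S = total w ss
        D₁ = depthSum w cs
        D₂ = depthSum w ss
        split : ∀ s v C D₁ D₂ a b c →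
          2 * s * (v + C + D₁ + D₂) + (a + b + c) ≡
          (2 * s * D₁ + b) + (2 * s * D₂ + c) + (s * v + a) + 2 * C * s + s * v
        split = solve-∀
        gather : ∀ s v C S →
          (C * C + s * C) + (S * S + s * S) + v * v + 2 * C * v + s * v + (2 * v * S + 2 * C * S) ≡
          (v + C + S) * (v + C + S) + s * (v + C + S)
        gather = solve-∀

      -- The quadratic bound is applied to each branch alone, as the forest `node y cs ∅`. The cap
      -- turns 2 T² into n T, which is linear in the branch weight and adds up over the branches.
      depthSum-bound-capped : ∀ {R} → (∀ {x y} → R x y → Heavy y) → ∀ n x F →
        Linked R x F → Capped w n F →
        4 * s * depthSum w F + 2 * total r F ≤ n * total w F + 2 * s * total w F
      depthSum-bound-capped good n x ∅ _ _ rewrite *-zeroʳ (4 * s) = z≤n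
      depthSum-bound-capped good n x (node y cs ss) (xy , lc , ls) (cap , cap-ss) = begin
        4 * s * (T + D₁ + D₂) + 2 * (r y + total r cs + total r ss)
          ≡⟨ split s T D₁ D₂ (r y) (total r cs) (total r ss) ⟩
        2 * (2 * s * (T + D₁ + 0) + (r y + total r cs + 0)) + (4 * s * D₂ + 2 * total r ss)
          ≤⟨ +-mono-≤ (*-monoʳ-≤ 2 (depthSum-bound good x (node y cs ∅) (xy , lc , tt)))
                      (depthSum-bound-capped good n x ss ls cap-ss) ⟩
        2 * ((T + 0) * (T + 0) + s * (T + 0)) + (n * S + 2 * s * S)
          ≡⟨ regroup s n T S ⟩
        2 * T * T + (n * S + 2 * s * (T + S))
          ≤⟨ +-monoˡ-≤ _ (*-monoˡ-≤ T cap) ⟩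
        n * T + (n * S + 2 * s * (T + S))
          ≡⟨ gather s n T S ⟩
        n * (T + S) + 2 * s * (T + S) ∎
        where
        open ≤-Reasoning
        T = w y + total w cs
        S = total w ss
        D₁ = depthSum w cs
        D₂ = depthSum w ss
        split : ∀ s T D₁ D₂ a b c →
          4 * s * (T + D₁ + D₂) + 2 * (a + b + c) ≡
          2 * (2 * s * (T + D₁ + 0) + (a + b + 0)) + (4 * s * D₂ + 2 * c)
        split = solve-∀
        regroup : ∀ s n T S →
          2 * ((T + 0) * (T + 0) + s * (T + 0)) + (n * S + 2 * s * S) ≡
          2 * T * T + (n * S + 2 * s * (T + S))
        regroup = solve-∀
        gather : ∀ s n T S →
          n * T + (n * S + 2 * s * (T + S)) ≡ n * (T + S) + 2 * s * (T + S)
        gather = solve-∀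

    -- `j` is the depth of `x`, the parent of the roots. Going down the tree, each edge adds at most
    -- `ℓ` to the distance from `c`. `depthSum` counts depths from `x`; the term `j * total w F`
    -- makes up the difference.
    weighted-dist-bound : ∀ {R} (w : X → ℕ) (d : X → X → ℕ) →
      (∀ x y z → d x z ≤ d x y + d y z) → ∀ ℓ → (∀ {x y} → R x y → d x y ≤ ℓ) →
      ∀ c x j F → Linked R x F → d c x ≤ ℓ * j →
      total (λ a → w a * d c a) F ≤ ℓ * (depthSum w F + j * total w F)
    weighted-dist-bound w d tri ℓ near c x j ∅ _ _ = z≤n
    weighted-dist-bound w d tri ℓ near c x j (node y cs ss) (xy , lc , ls) dcx = begin
      w y * d c y + total g cs + total g ss
        ≤⟨ +-mono-≤ (+-mono-≤ (*-monoʳ-≤ (w y) dcy)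
             (weighted-dist-bound w d tri ℓ near c y (suc j) cs lc dcy))
             (weighted-dist-bound w d tri ℓ near c x j ss ls dcx) ⟩
      w y * (ℓ * suc j) + ℓ * (D₁ + suc j * C) + ℓ * (D₂ + j * S)
        ≡⟨ gather ℓ j (w y) C S D₁ D₂ ⟩
      ℓ * ((w y + C + D₁ + D₂) + j * (w y + C + S)) ∎
      where
      open ≤-Reasoning
      g = λ a → w a * d c a
      C = total w cs
      S = total w ss
      D₁ = depthSum w cs
      D₂ = depthSum w ss
      dcy : d c y ≤ ℓ * suc j
      dcy = begin
        d c y          ≤⟨ tri c x y ⟩
        d c x + d x y  ≤⟨ +-mono-≤ dcx (near xy) ⟩
        ℓ * j + ℓ      ≡⟨ +-comm (ℓ * j) ℓ ⟩
        ℓ + ℓ * j      ≡⟨ ≡-sym (*-suc ℓ j) ⟩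
        ℓ * suc j      ∎
      gather : ∀ ℓ j v C S D₁ D₂ →
        v * (ℓ * (1 + j)) + ℓ * (D₁ + (1 + j) * C) + ℓ * (D₂ + j * S) ≡
        ℓ * ((v + C + D₁ + D₂) + j * (v + C + S))
      gather = solve-∀

-- Packings with pairwise distance at least 3 and the weighted trees on them.

module PackingTrees where

  open Forests
  open import Data.Nat using (zero; _+_; _*_; _∸_; _≤_; z≤n; s≤s; _≤?_; _⊔_; _⊓_)
  open import Data.Nat.Properties hiding (_≟_)
  open import Data.Nat.Tactic.RingSolver using (solve-∀)

  -- The Iverson bracket.
  ⟦_⟧ : {P : Set} → Dec P → ℕ
  ⟦ yes _ ⟧ = 1
  ⟦ no  _ ⟧ = 0

  -- Finite sums and double counting.

  module _ {X : Set} where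

    ∑ : (X → ℕ) → List X → ℕ
    ∑ f xs = sum (map f xs)

    ∑-+ : ∀ (f g : X → ℕ) xs → ∑ (λ x → f x + g x) xs ≡ ∑ f xs + ∑ g xs
    ∑-+ f g []       = refl
    ∑-+ f g (x ∷ xs) rewrite ∑-+ f g xs = lemma (f x) (g x) (∑ f xs) (∑ g xs)
      where
      lemma : ∀ a b c d → a + b + (c + d) ≡ a + c + (b + d)
      lemma = solve-∀

    ∑-cong : ∀ {f g : X → ℕ} → (∀ x → f x ≡ g x) → ∀ xs → ∑ f xs ≡ ∑ g xs
    ∑-cong f≡g []       = refl
    ∑-cong f≡g (x ∷ xs) = cong₂ _+_ (f≡g x) (∑-cong f≡g xs)

    ∑-mono : ∀ {f g : X → ℕ} → (∀ x → f x ≤ g x) → ∀ xs → ∑ f xs ≤ ∑ g xs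
    ∑-mono f≤g []       = z≤n
    ∑-mono f≤g (x ∷ xs) = +-mono-≤ (f≤g x) (∑-mono f≤g xs)

    ∑-const : ∀ c (xs : List X) → ∑ (λ _ → c) xs ≡ length xs * c
    ∑-const c []       = refl
    ∑-const c (x ∷ xs) = cong (c +_) (∑-const c xs)

    ∈⇒≤∑ : ∀ (f : X → ℕ) {x xs} → x ∈ xs → f x ≤ ∑ f xs
    ∈⇒≤∑ f {xs = _ ∷ xs} (here refl) = m≤m+n _ _
    ∈⇒≤∑ f {xs = x ∷ xs} (there p)   = ≤-trans (∈⇒≤∑ f p) (m≤n+m _ (f x))

    length-filter-∑ : ∀ {P : X → Set} (P? : ∀ x → Dec (P x)) xs →
      length (filter P? xs) ≡ ∑ (λ x → ⟦ P? x ⟧) xs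
    length-filter-∑ P? [] = refl
    length-filter-∑ P? (x ∷ xs) with P? x
    ... | yes _ = cong suc (length-filter-∑ P? xs)
    ... | no  _ = length-filter-∑ P? xs

    lookup-unique : ∀ {xs : List X} → Unique xs → ∀ {i j} → lookup xs i ≡ lookup xs j → i ≡ j
    lookup-unique (_  ∷ u) {zero}  {zero}  _  = refl
    lookup-unique {_ ∷ xs} (x≢ ∷ u) {zero}  {suc j} eq = contradiction eq (All.lookup x≢ (∈-lookup {xs = xs} j))
    lookup-unique {_ ∷ xs} (x≢ ∷ u) {suc i} {zero}  eq = contradiction (≡-sym eq) (All.lookup x≢ (∈-lookup {xs = xs} i))
    lookup-unique (_  ∷ u) {suc i} {suc j} eq = cong suc (lookup-unique u eq)

  module _ {n : ℕ} where

    ∑-indicator-∉ : ∀ b (f : Fin n → ℕ) A → All (b ≢_) A → ∑ (λ a → ⟦ b ≟ a ⟧ * f a) A ≡ 0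
    ∑-indicator-∉ b f []      []          = refl
    ∑-indicator-∉ b f (a ∷ A) (b≢a ∷ b∉A) with b ≟ a
    ... | yes b≡a = contradiction b≡a b≢a
    ... | no  _   = ∑-indicator-∉ b f A b∉A

    ∑-indicator : ∀ {b} (f : Fin n → ℕ) {A} → Unique A → b ∈ A →
      ∑ (λ a → ⟦ b ≟ a ⟧ * f a) A ≡ f b
    ∑-indicator {b} f {a ∷ A} (a∉A ∷ u) p with b ≟ a | p
    ... | yes refl | _        rewrite ∑-indicator-∉ b f A a∉A = lemma (f b)
      where
      lemma : ∀ x → x + 0 + 0 ≡ x
      lemma = solve-∀
    ... | no b≢a   | here b≡a = contradiction b≡a b≢a
    ... | no b≢a   | there q  = ∑-indicator f u q

    -- For `α` the assignment of vertices to a packing, this is the weight of its member `a`.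
    fibre : (Fin n → Fin n) → List (Fin n) → Fin n → ℕ
    fibre α vs a = ∑ (λ v → ⟦ α v ≟ a ⟧) vs

    -- Double counting: `v` contributes at `α v` only, and once since `A` has no repetitions.
    -- Constant `f` gives the total weight, distances from `c` the weighted distance sum.
    ∑-fibre : ∀ (α : Fin n → Fin n) (f : Fin n → ℕ) {A} → Unique A → (∀ v → α v ∈ A) → ∀ vs →
      ∑ (λ a → fibre α vs a * f a) A ≡ ∑ (λ v → f (α v)) vs
    ∑-fibre α f {A} u α∈A [] = trans (∑-const 0 A) (*-zeroʳ (length A))
    ∑-fibre α f {A} u α∈A (v ∷ vs) = begin
      ∑ (λ a → (⟦ α v ≟ a ⟧ + fibre α vs a) * f a) A
        ≡⟨ ∑-cong (λ a → *-distribʳ-+ (f a) ⟦ α v ≟ a ⟧ (fibre α vs a)) A ⟩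
      ∑ (λ a → ⟦ α v ≟ a ⟧ * f a + fibre α vs a * f a) A
        ≡⟨ ∑-+ (λ a → ⟦ α v ≟ a ⟧ * f a) (λ a → fibre α vs a * f a) A ⟩
      ∑ (λ a → ⟦ α v ≟ a ⟧ * f a) A + ∑ (λ a → fibre α vs a * f a) A
        ≡⟨ cong₂ _+_ (∑-indicator f u (α∈A v)) (∑-fibre α f u α∈A vs) ⟩
      f (α v) + ∑ (λ v → f (α v)) vs ∎
      where open ≡-Reasoning

  -- Lists grown from a root, read as trees.

  data Grown {X : Set} (Q : X → X → Set) (z : X) : List X → Set where
    root : Grown Q z (z ∷ [])
    -- The new entry records its parent `a`, so a proof carries a tree rooted at `z`.
    grow : ∀ {a y A} → a ∈ A → Q a y → Grown Q z A → Grown Q z (y ∷ A)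

  module _ {X : Set} {Q : X → X → Set} {z : X} where

    root∈ : ∀ {A} → Grown Q z A → z ∈ A
    root∈ root         = here refl
    root∈ (grow _ _ g) = there (root∈ g)

    -- Totals determine the multiset of labels, which is how the forest is tied to A.
    toForest : ∀ {P : X → Set} {A} → Grown Q z A → All P A →
      ∃ λ F → Linked (λ x y → Q x y × P x × P y) z F ×
              (∀ g → g z + total g F ≡ ∑ g A) × (∀ {a} → a ∈ A → a ≡ z ⊎ a ∈ᶠ F)
    toForest root _ = ∅ , tt , (λ g → refl) , λ { (here eq) → inj₁ eq }
    toForest {P} {A} (grow {a} {y} {A₀} a∈A q g) (py ∷ pA) with toForest g pA
    ... | F , lF , same , place with place a∈A
    -- The parent is `z`, below which the whole forest hangs: the new vertex becomes one of its
    -- roots.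
    ... | inj₁ refl = node y ∅ F , ((q , All.lookup pA a∈A , py) , tt , lF) , same′ , place′
      where
      lemma : ∀ z y f → z + (y + 0 + f) ≡ y + (z + f)
      lemma = solve-∀
      same′ : ∀ g → g z + (g y + 0 + total g F) ≡ ∑ g (y ∷ A₀)
      same′ g = trans (lemma (g z) (g y) (total g F)) (cong (g y +_) (same g))
      place′ : ∀ {b} → b ∈ y ∷ A₀ → b ≡ z ⊎ b ∈ᶠ node y ∅ F
      place′ (here refl) = inj₂ here
      place′ (there p) with place p
      ... | inj₁ eq = inj₁ eq
      ... | inj₂ m  = inj₂ (sibling m)
    ... | inj₂ pos = insert pos y , Linked-insert pos lF (q , All.lookup pA a∈A , py) , same′ , place′
      where
      lemma : ∀ z y f → z + (y + f) ≡ y + (z + f)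
      lemma = solve-∀
      same′ : ∀ g → g z + total g (insert pos y) ≡ ∑ g (y ∷ A₀)
      same′ g = trans (cong (g z +_) (total-insert g pos y))
               (trans (lemma (g z) (g y) (total g F)) (cong (g y +_) (same g)))
      place′ : ∀ {b} → b ∈ y ∷ A₀ → b ≡ z ⊎ b ∈ᶠ insert pos y
      place′ (here refl) = inj₂ (∈ᶠ-insert-new pos _)
      place′ (there p) with place p
      ... | inj₁ eq = inj₁ eq
      ... | inj₂ m  = inj₂ (∈ᶠ-insert-old pos y m)

  -- Walks, distances and maximal packings.

  module _ {n : ℕ} {G : Graph n} where

    _++ʷ_ : ∀ {u v x k l} → Walk G u v k → Walk G v x l → Walk G u x (k + l)
    []      ++ʷ q = q
    (e ∷ p) ++ʷ q = e ∷ (p ++ʷ q)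

    reverseʷ : ∀ {u v k} → Walk G u v k → Walk G v u k
    reverseʷ [] = []
    reverseʷ {k = suc k} (e ∷ p) =
      subst (Walk G _ _) (+-comm k 1) (reverseʷ p ++ʷ (Defs.sym G e ∷ []))

    boundary : ∀ {C : Fin n → Set} → (∀ v → Dec (C v)) → ∀ {u v k} → Walk G u v k →
      C u → ¬ C v → ∃₂ λ x y → Adj G x y × C x × ¬ C y
    boundary C? []              cu ¬cv = contradiction cu ¬cv
    boundary C? (_∷_ {w = w} e p) cu ¬cv with C? w
    ... | yes cw = boundary C? p cw ¬cv
    ... | no ¬cw = _ , _ , e , cu , ¬cw

  module Packing {n : ℕ} (G : Graph n) (conn : Connected G)
                 (d : Fin n → Fin n → ℕ) (isD : IsDistance G d) where

    d-walk : ∀ u v → Walk G u v (d u v)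
    d-walk u v = proj₁ (isD u v)

    d-min : ∀ {u v m} → Walk G u v m → d u v ≤ m
    d-min {u} {v} p = proj₂ (isD u v) _ p

    d-sym : ∀ u v → d u v ≤ d v u
    d-sym u v = d-min (reverseʷ (d-walk v u))

    d-triangle : ∀ u v x → d u x ≤ d u v + d v x
    d-triangle u v x = d-min (d-walk u v ++ʷ d-walk v x)

    Near Far : Fin n → Fin n → Set
    Near a b = d a b ≤ 3
    Far  a b = ¬ (d a b ≤ 2)

    Far⇒≢ : ∀ {a b} → Far a b → a ≢ b
    Far⇒≢ far refl = far (≤-trans (d-min []) z≤n)

    Packed : List (Fin n) → Set
    Packed = AllPairs Far

    unique : ∀ {A} → Packed A → Unique A
    unique = AllPairs.map Far⇒≢

    Covered : List (Fin n) → Fin n → Set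
    Covered A v = Any (λ a → d a v ≤ 2) A

    covered? : ∀ A v → Dec (Covered A v)
    covered? A v = Any.any? (λ a → d a v ≤? 2) A

    -- `m` is fuel. It cannot run out: a packing has no repetitions, hence at most `n` members.
    -- Stopping happens exactly when every vertex is covered.
    extendPacking : ∀ z m A → Grown Near z A → Packed A → length A + m ≡ suc n →
      ∃ λ A → Grown Near z A × Packed A × (∀ v → Covered A v)
    extendPacking z zero A _ far eq = contradiction
      (injective⇒≤ (lookup-unique (unique far)))
      (λ le → 1+n≰n (subst (_≤ n) (trans (≡-sym (+-identityʳ _)) eq) le))
    extendPacking z (suc m) A grown far eq with all? (covered? A)
    ... | yes cov = A , grown , far , cov
    ... | no ¬cov with ¬∀⟶∃¬ n _ (covered? A) ¬cov
    -- `z` covers itself, so a walk to `v` has an edge from a covered `x` to an uncovered `y`. Then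
    -- `y` is far from all of `A`, yet at distance at most 2 + 1 from the member covering `x`.
    ... | v , ¬cv with boundary (covered? A) (proj₂ (conn z v))
                         (lose (root∈ grown) (≤-trans (d-min []) z≤n)) ¬cv
    ... | x , y , xy , cx , ¬cy with find cx
    ... | a , a∈A , dax = extendPacking z m (y ∷ A) (grow a∈A day grown)
            (All.map (λ {b} far dyb → far (≤-trans (d-sym b y) dyb)) (¬Any⇒All¬ A ¬cy) ∷ far)
            (trans (≡-sym (+-suc (length A) m)) eq)
      where
      day : d a y ≤ 3
      day = ≤-trans (d-triangle a x y) (+-mono-≤ dax (d-min (xy ∷ [])))

    maximalPacking : ∀ z → ∃ λ A → Grown Near z A × Packed A × (∀ v → Covered A v)
    maximalPacking z = extendPacking z n (z ∷ []) root ([] ∷ []) refl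

    packed-≡ : ∀ {A a b} → Packed A → a ∈ A → b ∈ A → d a b ≤ 2 → a ≡ b
    packed-≡ _           (here refl) (here refl) _  = refl
    packed-≡ (far ∷ _)   (here refl) (there q)   le = contradiction le (All.lookup far q)
    packed-≡ {a = a} {b} (far ∷ _) (there p) (here refl) le =
      contradiction (≤-trans (d-sym b a) le) (All.lookup far p)
    packed-≡ (_ ∷ ps)    (there p)   (there q)   le = packed-≡ ps p q le

    -- A member at distance at most 1 is preferred. There is at most one, as two would be within
    -- distance 2 of each other; so each member owns its closed neighbourhood.
    assign : ∀ {A} → Packed A → (∀ v → Covered A v) → ∀ v →
      ∃ λ a → a ∈ A × d a v ≤ 2 × (∀ {b} → b ∈ A → d b v ≤ 1 → a ≡ b)
    assign {A} packed cov v with Any.any? (λ a → d a v ≤? 1) A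
    ... | yes near = let a , a∈A , dav = find near in
      a , a∈A , ≤-trans dav (s≤s z≤n) ,
      λ {b} b∈A dbv → packed-≡ packed a∈A b∈A
        (≤-trans (d-triangle a v b) (+-mono-≤ dav (≤-trans (d-sym v b) dbv)))
    ... | no ¬near = let a , a∈A , dav = find (cov v) in
      a , a∈A , dav , λ b∈A dbv → contradiction (lose b∈A dbv) ¬near

    -- The closed neighbourhood of `a` lies in the fibre; by irreflexivity `a` and its neighbours
    -- are counted separately.
    degree<fibre : ∀ (α : Fin n → Fin n) a → (∀ v → d a v ≤ 1 → α v ≡ a) →
      suc (degree G a) ≤ fibre α (allFin n) a
    degree<fibre α a owns = begin
      suc (degree G a)
        ≤⟨ +-mono-≤ counts-a (≤-reflexive (length-filter-∑ (adj? G a) (allFin n))) ⟩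
      ∑ (λ v → ⟦ a ≟ v ⟧) (allFin n) + ∑ (λ v → ⟦ adj? G a v ⟧) (allFin n)
        ≡⟨ ≡-sym (∑-+ (λ v → ⟦ a ≟ v ⟧) (λ v → ⟦ adj? G a v ⟧) (allFin n)) ⟩
      ∑ (λ v → ⟦ a ≟ v ⟧ + ⟦ adj? G a v ⟧) (allFin n)
        ≤⟨ ∑-mono pointwise (allFin n) ⟩
      fibre α (allFin n) a ∎
      where
      open ≤-Reasoning
      counts-a : 1 ≤ ∑ (λ v → ⟦ a ≟ v ⟧) (allFin n)
      counts-a = ≤-trans self (∈⇒≤∑ (λ v → ⟦ a ≟ v ⟧) (∈-allFin a))
        where
        self : 1 ≤ ⟦ a ≟ a ⟧
        self with a ≟ a
        ... | yes _ = ≤-refl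
        ... | no ¬p = contradiction refl ¬p
      pointwise : ∀ v → ⟦ a ≟ v ⟧ + ⟦ adj? G a v ⟧ ≤ ⟦ α v ≟ a ⟧
      pointwise v with a ≟ v | adj? G a v | α v ≟ a
      ... | yes refl | yes e | _     = contradiction e (irrefl G)
      ... | yes refl | no _  | yes _ = ≤-refl
      ... | yes refl | no _  | no ¬p = contradiction (owns a (≤-trans (d-min []) z≤n)) ¬p
      ... | no _     | yes e | yes _ = ≤-refl
      ... | no _     | yes e | no ¬p = contradiction (owns v (d-min (e ∷ []))) ¬p
      ... | no _     | no _  | _     = z≤n

  -- Extremal values over lists.

  module _ {X : Set} where

    foldr-⊓-≤ : ∀ (f : X → ℕ) e {x xs} → x ∈ xs → foldr _⊓_ e (map f xs) ≤ f x
    foldr-⊓-≤ f e (here refl) = m⊓n≤m _ _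
    foldr-⊓-≤ f e (there p)   = ≤-trans (m⊓n≤n _ _) (foldr-⊓-≤ f e p)

    ∈⇒≤foldr-⊔ : ∀ (f : X → ℕ) {x xs} → x ∈ xs → f x ≤ foldr _⊔_ 0 (map f xs)
    ∈⇒≤foldr-⊔ f (here refl)            = m≤m⊔n _ _
    ∈⇒≤foldr-⊔ f {xs = y ∷ _} (there p) = ≤-trans (∈⇒≤foldr-⊔ f p) (m≤n⊔m (f y) _)

    foldr-⊔-attained : ∀ (f : X → ℕ) x xs → ∃ λ y → foldr _⊔_ 0 (map f (x ∷ xs)) ≤ f y
    foldr-⊔-attained f x []       = x , ≤-reflexive (⊔-identityʳ (f x))
    foldr-⊔-attained f x (y ∷ xs) with foldr-⊔-attained f y xs
    ... | y′ , le with ≤-total (f x) (f y′)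
    ... | inj₁ x≤y = y′ , ⊔-lub x≤y le
    ... | inj₂ y≤x = x , ⊔-lub ≤-refl (≤-trans le y≤x)

  -- The weighted tree on a maximal packing.

  module _ {n : ℕ} (G : Graph n) (conn : Connected G)
           (d : Fin n → Fin n → ℕ) (isD : IsDistance G d) where

    open Packing G conn d isD

    -- The weight bounds are kept at both ends to make the relation symmetric, as rerooting at a
    -- centroid demands.
    Edge : (Fin n → ℕ) → Fin n → Fin n → Set
    Edge w x y = Near x y × suc (degree G x) ≤ w x × suc (degree G y) ≤ w y

    Edge-sym : ∀ {w x y} → Edge w x y → Edge w y x
    Edge-sym {x = x} {y} (near , wx , wy) = ≤-trans (d-sym y x) near , wy , wx

    -- The last component covers every rerooting of the tree, so it serves both `z` and the
    -- centroid. Replacing `v` by its assigned member costs at most 2 per vertex, whence 2 n; tree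
    -- edges have length at most 3.
    packingTree : ∀ z → ∃₂ λ w F →
      suc (degree G z) ≤ w z × Linked (Edge w) z F × w z + total w F ≡ n ×
      (∀ c F′ → Linked (Edge w) c F′ → (∀ g → g c + total g F′ ≡ g z + total g F) →
         ∑ (d c) (allFin n) ≤ 3 * depthSum w F′ + 2 * n)
    packingTree z with maximalPacking z
    ... | A , grown , packed , cov =
      w , F , All.lookup heavy (root∈ grown) , linked , total≡n , bound
      where
      α : Fin n → Fin n
      α v = proj₁ (assign packed cov v)
      α∈A : ∀ v → α v ∈ A
      α∈A v = proj₁ (proj₂ (assign packed cov v))
      dα : ∀ v → d (α v) v ≤ 2
      dα v = proj₁ (proj₂ (proj₂ (assign packed cov v)))
      w : Fin n → ℕ
      w = fibre α (allFin n)
      heavy : All (λ a → suc (degree G a) ≤ w a) A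
      heavy = All.tabulate λ {a} a∈A →
        degree<fibre α a λ v dav → proj₂ (proj₂ (proj₂ (assign packed cov v))) a∈A dav
      forest = toForest grown heavy
      F = proj₁ forest
      linked = proj₁ (proj₂ forest)
      same = proj₁ (proj₂ (proj₂ forest))
      length-allFin : length (allFin n) ≡ n
      length-allFin = length-tabulate {n = n} id
      total≡n : w z + total w F ≡ n
      total≡n = begin
        w z + total w F                   ≡⟨ same w ⟩
        ∑ w A                             ≡⟨ ∑-cong (λ a → ≡-sym (*-identityʳ (w a))) A ⟩
        ∑ (λ a → w a * 1) A               ≡⟨ ∑-fibre α (λ _ → 1) (unique packed) α∈A (allFin n) ⟩
        ∑ (λ _ → 1) (allFin n)            ≡⟨ ∑-const 1 (allFin n) ⟩
        length (allFin n) * 1             ≡⟨ *-identityʳ _ ⟩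
        length (allFin n)                 ≡⟨ length-allFin ⟩
        n                                 ∎
        where open ≡-Reasoning
      bound : ∀ c F′ → Linked (Edge w) c F′ → (∀ g → g c + total g F′ ≡ g z + total g F) →
        ∑ (d c) (allFin n) ≤ 3 * depthSum w F′ + 2 * n
      bound c F′ linked′ same′ = begin
        ∑ (d c) (allFin n)
          ≤⟨ ∑-mono (λ v → ≤-trans (d-triangle c (α v) v) (+-monoʳ-≤ (d c (α v)) (dα v))) (allFin n) ⟩
        ∑ (λ v → d c (α v) + 2) (allFin n)
          ≡⟨ ∑-+ (λ v → d c (α v)) (λ _ → 2) (allFin n) ⟩
        ∑ (λ v → d c (α v)) (allFin n) + ∑ (λ _ → 2) (allFin n)
          ≡⟨ cong₂ _+_ (≡-sym (∑-fibre α (d c) (unique packed) α∈A (allFin n)))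
               (trans (∑-const 2 (allFin n)) (trans (cong (_* 2) length-allFin) (*-comm n 2))) ⟩
        ∑ g A + 2 * n
          ≡⟨ cong (_+ 2 * n) (trans (≡-sym (same g)) (≡-sym (same′ g))) ⟩
        w c * d c c + total g F′ + 2 * n
          ≤⟨ +-monoˡ-≤ (2 * n) (+-mono-≤ (*-monoʳ-≤ (w c) dcc)
               (weighted-dist-bound w d d-triangle 3 proj₁ c c 0 F′ linked′ dcc)) ⟩
        w c * 0 + 3 * (depthSum w F′ + 0) + 2 * n
          ≡⟨ cong₂ (λ a b → a + 3 * b + 2 * n) (*-zeroʳ (w c)) (+-identityʳ (depthSum w F′)) ⟩
        3 * depthSum w F′ + 2 * n ∎
        where
        open ≤-Reasoning
        g = λ a → w a * d c a
        dcc : d c c ≤ 0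
        dcc = d-min []

  -- The two bounds on distance sums, to be used with `K` = n - 1, `s` = δ + 1 and `h` = Δ + 1.

  module SumBounds {v : ℕ} (n K s Δ h : ℕ)
    (n≤1+K : n ≤ suc K) (n≤2K : n ≤ 2 * K) (s≤h : s ≤ h) (Δ<h : suc Δ ≤ h)
    (R : Fin v → Fin v → Set) (R-sym : ∀ {x y} → R x y → R y x)
    (w : Fin v → ℕ) (s≤w : ∀ {x y} → R x y → s ≤ w y)
    (z : Fin v) (F : Forest (Fin v))
    (h≤wz : h ≤ w z) (linked : Linked R z F) (total≡n : w z + total w F ≡ n)
    (σ : Fin v → ℕ)
    (σ-bound : ∀ c F′ → Linked R c F′ → (∀ g → g c + total g F′ ≡ g z + total g F) →
       σ c ≤ 3 * depthSum w F′ + 2 * n)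
    where

    Δ+total<n : suc (Δ + total w F) ≤ n
    Δ+total<n = ≤-trans (+-monoˡ-≤ (total w F) (≤-trans Δ<h h≤wz)) (≤-reflexive total≡n)

    sum-bound-from-z : ∃ λ c → 2 * s * σ c ≤ 3 * ((n ∸ Δ) * (n ∸ Δ)) + 13 * s * K
    sum-bound-from-z = z , (begin
      2 * s * σ z
        ≤⟨ *-monoʳ-≤ (2 * s) (σ-bound z F linked (λ _ → refl)) ⟩
      2 * s * (3 * E + 2 * n)
        ≡⟨ split s E n ⟩
      3 * (2 * s * E) + 4 * s * n
        -- The saving is zero here: `z` is the root, and its weight is already absent from `W`.
        ≤⟨ +-mono-≤ (*-monoʳ-≤ 3 (m+n≤o⇒m≤o (2 * s * E) (depthSum-bound w (λ _ → 0) s good z F linked)))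
                    (*-monoʳ-≤ (4 * s) n≤2K) ⟩
      3 * (W * W + s * W) + 4 * s * (2 * K)
        ≤⟨ +-monoˡ-≤ _ (*-monoʳ-≤ 3 (+-mono-≤ (*-mono-≤ W≤m W≤m) (*-monoʳ-≤ s W≤K))) ⟩
      3 * (m * m + s * K) + 4 * s * (2 * K)
        -- The error so far is 3 s K + 8 s K; the rest fills it up to 13 s K.
        ≤⟨ m≤m+n _ (2 * s * K) ⟩
      3 * (m * m + s * K) + 4 * s * (2 * K) + 2 * s * K
        ≡⟨ gather s m K ⟩
      3 * (m * m) + 13 * s * K ∎)
      where
      open ≤-Reasoning
      E = depthSum w F
      W = total w F
      m = n ∸ Δ
      W≤m : W ≤ m
      W≤m = m+n≤o⇒m≤o∸n W (≤-trans (≤-reflexive (+-comm W Δ)) (≤-trans (n≤1+n _) Δ+total<n))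
      W≤K : W ≤ K
      W≤K = ≤-pred (≤-trans (s≤s (m≤n+m W Δ)) (≤-trans Δ+total<n n≤1+K))
      good : ∀ {x y} → R x y → Heavy w (λ _ → 0) s y
      good {y = y} xy = s≤wy , ≤-trans (≤-reflexive (+-identityʳ _)) (*-monoˡ-≤ (w y) s≤wy)
        where s≤wy = s≤w xy
      split : ∀ s E n → 2 * s * (3 * E + 2 * n) ≡ 3 * (2 * s * E) + 4 * s * n
      split = solve-∀
      gather : ∀ s m K → 3 * (m * m + s * K) + 4 * s * (2 * K) + 2 * s * K ≡ 3 * (m * m) + 13 * s * K
      gather = solve-∀

    -- The negative term 2 Δ² of the numerator stands on the left to stay within ℕ. It is gained
    -- either from the weight of `z` as the root or from its saving inside a branch.
    sum-bound-from-centroid : 2 * h ≤ n →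
      ∃ λ c → 4 * s * σ c + 6 * (Δ * Δ) ≤ 3 * (n * n) + 35 * s * K
    sum-bound-from-centroid 2h≤n
      with centroid R-sym w n z F ∅ linked tt tt (trans (+-identityʳ _) total≡n)
    ... | c , F′ , linked′ , capped , same₀ = c , (begin
      4 * s * σ c + 6 * (Δ * Δ)
        ≤⟨ +-mono-≤ (*-monoʳ-≤ (4 * s) (σ-bound c F′ linked′ same))
                    (*-monoʳ-≤ 6 (*-mono-≤ (<⇒≤ Δ<h) (<⇒≤ Δ<h))) ⟩
      4 * s * (3 * E + 2 * n) + 6 * (h * h)
        ≡⟨ split s E n h ⟩
      3 * (4 * s * E + 2 * (h * h)) + 8 * s * n
        ≤⟨ +-monoˡ-≤ (8 * s * n) (*-monoʳ-≤ 3 (depth-bound (z ≟ c))) ⟩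
      3 * (n * n + 3 * s * n) + 8 * s * n
        ≡⟨ regroup s n ⟩
      3 * (n * n) + 17 * s * n
        -- 17 = 9 + 8, from the depths and from the assignment; doubled it gives 34, one below 35.
        ≤⟨ +-monoʳ-≤ (3 * (n * n)) (*-monoʳ-≤ (17 * s) n≤2K) ⟩
      3 * (n * n) + 17 * s * (2 * K)
        ≤⟨ m≤m+n _ (s * K) ⟩
      3 * (n * n) + 17 * s * (2 * K) + s * K
        ≡⟨ gather s n K ⟩
      3 * (n * n) + 35 * s * K ∎)
      where
      open ≤-Reasoning
      E = depthSum w F′
      W = total w F′
      e = h ∸ s
      -- q = h² − s h is the saving due to the heavy vertex z.
      q = h * e
      r : Fin v → ℕ
      r x = ⟦ z ≟ x ⟧ * q

      same : ∀ g → g c + total g F′ ≡ g z + total g F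
      same g = trans (same₀ g) (+-identityʳ _)

      s+e≡h : s + e ≡ h
      s+e≡h = m+[n∸m]≡n s≤h

      good : ∀ {x y} → R x y → Heavy w r s y
      good {y = y} xy = s≤wy , saving
        where
        s≤wy = s≤w xy
        saving : s * w y + ⟦ z ≟ y ⟧ * q ≤ w y * w y
        saving with z ≟ y
        ... | no _     = ≤-trans (≤-reflexive (+-identityʳ _)) (*-monoˡ-≤ (w y) s≤wy)
        ... | yes refl = begin
          s * w z + (q + 0)      ≡⟨ cong (s * w z +_) (+-identityʳ q) ⟩
          s * w z + h * e        ≤⟨ +-monoʳ-≤ (s * w z) (*-monoˡ-≤ e h≤wz) ⟩
          s * w z + w z * e      ≡⟨ factor s (w z) e ⟩
          w z * (s + e)          ≡⟨ cong (w z *_) s+e≡h ⟩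
          w z * h                ≤⟨ *-monoʳ-≤ (w z) h≤wz ⟩
          w z * w z              ∎
          where
          factor : ∀ s w e → s * w + w * e ≡ w * (s + e)
          factor = solve-∀

      capped-bound : 4 * s * E + 2 * total r F′ ≤ n * W + 2 * s * W
      capped-bound = depthSum-bound-capped w r s good n c F′ linked′ capped

      w+W≡n : w c + W ≡ n
      w+W≡n = trans (same w) total≡n

      W≤n : W ≤ n
      W≤n = ≤-trans (m≤n+m W (w c)) (≤-reflexive w+W≡n)

      depth-bound : Dec (z ≡ c) → 4 * s * E + 2 * (h * h) ≤ n * n + 3 * s * n
      -- The branches share only the weight outside `c`, so W ≤ n - h; the freed n h is at least 2
      -- h².
      depth-bound (yes z≡c) = begin
        4 * s * E + 2 * (h * h)
          ≤⟨ +-mono-≤ (m+n≤o⇒m≤o (4 * s * E) capped-bound) (≤-reflexive (≡-sym (*-assoc 2 h h))) ⟩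
        n * W + 2 * s * W + 2 * h * h
          ≤⟨ +-mono-≤ (+-monoʳ-≤ (n * W) (*-mono-≤ (*-monoˡ-≤ s (n≤1+n 2)) W≤n)) (*-monoˡ-≤ h 2h≤n) ⟩
        n * W + 3 * s * n + n * h
          ≡⟨ collect n W (3 * s * n) h ⟩
        n * (h + W) + 3 * s * n
          ≤⟨ +-monoˡ-≤ _ (*-monoʳ-≤ n (≤-trans (+-monoˡ-≤ W (subst (λ x → h ≤ w x) z≡c h≤wz)) (≤-reflexive w+W≡n))) ⟩
        n * n + 3 * s * n ∎
        where
        collect : ∀ n W t h → n * W + t + n * h ≡ n * (h + W) + t
        collect = solve-∀
      -- Now `z` lies in a branch. Twice its saving is 2 h² - 2 s h, and the missing 2 s h is at
      -- most s n.
      depth-bound (no z≢c) = begin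
        4 * s * E + 2 * (h * h)
          ≡⟨ cong (λ t → 4 * s * E + 2 * (h * t)) (≡-sym s+e≡h) ⟩
        4 * s * E + 2 * (h * (s + e))
          ≡⟨ expand s E h e ⟩
        4 * s * E + 2 * q + s * (2 * h)
          ≤⟨ +-mono-≤ (≤-trans (+-monoʳ-≤ (4 * s * E) (*-monoʳ-≤ 2 q≤R)) capped-bound) (*-monoʳ-≤ s 2h≤n) ⟩
        n * W + 2 * s * W + s * n
          ≤⟨ +-monoˡ-≤ (s * n) (+-mono-≤ (*-monoʳ-≤ n W≤n) (*-monoʳ-≤ (2 * s) W≤n)) ⟩
        n * n + 2 * s * n + s * n
          ≡⟨ collect n s ⟩
        n * n + 3 * s * n ∎
        where
        expand : ∀ s E h e → 4 * s * E + 2 * (h * (s + e)) ≡ 4 * s * E + 2 * (h * e) + s * (2 * h)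
        expand = solve-∀
        collect : ∀ n s → n * n + 2 * s * n + s * n ≡ n * n + 3 * s * n
        collect = solve-∀
        rc≡0 : r c ≡ 0
        rc≡0 with z ≟ c
        ... | yes eq = contradiction eq z≢c
        ... | no _   = refl
        q≤rz : q ≤ r z
        q≤rz with z ≟ z
        ... | yes _ = m≤m+n q 0
        ... | no ¬p = contradiction refl ¬p
        q≤R : q ≤ total r F′
        -- Rerooting preserves the total of `r` itself. As `r` vanishes at `c`, the saving must lie
        -- in `F′`.
        q≤R = begin
          q                  ≤⟨ q≤rz ⟩
          r z                ≤⟨ m≤m+n _ _ ⟩
          r z + total r F    ≡⟨ ≡-sym (same r) ⟩
          r c + total r F′   ≡⟨ cong (_+ total r F′) rc≡0 ⟩
          total r F′         ∎

      split : ∀ s E n h → 4 * s * (3 * E + 2 * n) + 6 * (h * h) ≡ 3 * (4 * s * E + 2 * (h * h)) + 8 * s * n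
      split = solve-∀
      regroup : ∀ s n → 3 * (n * n + 3 * s * n) + 8 * s * n ≡ 3 * (n * n) + 17 * s * n
      regroup = solve-∀
      gather : ∀ s n K → 3 * (n * n) + 17 * s * (2 * K) + s * K ≡ 3 * (n * n) + 35 * s * K
      gather = solve-∀

  sum-bounds : ∀ {n} (G : Graph n) → Connected G → (d : Fin n → Fin n → ℕ) → IsDistance G d →
    ∀ K s Δ z → n ≤ suc K → n ≤ 2 * K → s ≤ suc Δ → (∀ v → s ≤ suc (degree G v)) → Δ ≤ degree G z →
    Δ ≤ n ×
    (∃ λ c → 2 * s * ∑ (d c) (allFin n) ≤ 3 * ((n ∸ Δ) * (n ∸ Δ)) + 13 * s * K) ×
    (2 * suc Δ ≤ n →
     ∃ λ c → 4 * s * ∑ (d c) (allFin n) + 6 * (Δ * Δ) ≤ 3 * (n * n) + 35 * s * K)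
  sum-bounds {n} G conn d isD K s Δ z n≤1+K n≤2K s≤1+Δ s≤degree Δ≤degree
    with packingTree G conn d isD z
  ... | w , F , degree<w , linked , total≡n , σ-bound =
    <⇒≤ (≤-trans (s≤s (m≤m+n Δ _)) Δ+total<n) , sum-bound-from-z , sum-bound-from-centroid
    where
    s≤w : ∀ {x y} → Edge G conn d isD w x y → s ≤ w y
    s≤w {y = y} (_ , _ , degree<wy) = ≤-trans (s≤degree y) degree<wy
    open SumBounds n K s Δ (suc Δ) n≤1+K n≤2K s≤1+Δ ≤-refl
      (Edge G conn d isD w) (Edge-sym G conn d isD) w
      s≤w z F (≤-trans (s≤s Δ≤degree) degree<w) linked total≡n (λ c → ∑ (d c) (allFin n)) σ-bound

-- From inequalities of naturals to inequalities of fractions.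

module Fractions where

  open import Data.Integer as ℤ using (ℤ; +_; -[1+_])
  open import Data.Integer.Tactic.RingSolver using (solve-∀)
  open import Data.Rational using (ℚ; _/_; _+_; _-_; _≤_; _⊓_; toℚᵘ; -_)
  open import Data.Rational.Unnormalised as ℚᵘ using (mkℚᵘ; *≤*)
  import Data.Rational.Unnormalised.Properties as ℚᵘ

  foldr-⊓-≤ : ∀ {X : Set} (f : X → ℚ) e {x xs} → x ∈ xs → foldr _⊓_ e (map f xs) ≤ f x
  foldr-⊓-≤ f e (here refl)            = ℚ.p⊓q≤p _ _
  foldr-⊓-≤ f e {xs = y ∷ _} (there p) = ℚ.≤-trans (ℚ.p⊓q≤q (f y) _) (foldr-⊓-≤ f e p)

  toℚᵘ-/ : ∀ p m → toℚᵘ (p / suc m) ℚᵘ.≃ mkℚᵘ p m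
  toℚᵘ-/ p m = ℚ.toℚᵘ-fromℚᵘ (mkℚᵘ p m)

  -- Cross-multiplication turns the claim into the hypothesis multiplied by M K.
  frac-bound : ∀ p K S M c (N : ℤ)
    .{{_ : ℕ.NonZero K}} .{{_ : ℕ.NonZero S}} .{{_ : ℕ.NonZero M}} .{{_ : ℕ.NonZero (M ℕ.* K ℕ.* S)}} →
    + (M ℕ.* S ℕ.* p) ℤ.≤ N ℤ.+ + (c ℕ.* S ℕ.* K) →
    (+ p) / K ≤ N / (M ℕ.* K ℕ.* S) + (+ c) / M
  frac-bound p K@(suc k) S@(suc s) M@(suc m) c N le = ℚ.toℚᵘ-cancel-≤
    (ℚᵘ.≤-respˡ-≃ (ℚᵘ.≃-sym (toℚᵘ-/ (+ p) k))
    (ℚᵘ.≤-respʳ-≃ (ℚᵘ.≃-sym (ℚᵘ.≃-trans (ℚ.toℚᵘ-homo-+ (N / (M ℕ.* K ℕ.* S)) ((+ c) / M))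
        (ℚᵘ.+-cong (toℚᵘ-/ N _) (toℚᵘ-/ (+ c) m))))
    (*≤* (begin
      + p ℤ.* + (M ℕ.* K ℕ.* S ℕ.* M)
        ≡⟨ cong (+ p ℤ.*_) (trans (ℤ.pos-* (M ℕ.* K ℕ.* S) M) (cong (ℤ._* + M) MKS)) ⟩
      + p ℤ.* (+ M ℤ.* + K ℤ.* + S ℤ.* + M)
        ≡⟨ lhs (+ p) (+ M) (+ K) (+ S) ⟩
      + M ℤ.* + K ℤ.* (+ M ℤ.* + S ℤ.* + p)
        ≡⟨ cong₂ ℤ._*_ (≡-sym (ℤ.pos-* M K)) (≡-sym (trans (ℤ.pos-* (M ℕ.* S) p) (cong (ℤ._* + p) (ℤ.pos-* M S)))) ⟩
      + (M ℕ.* K) ℤ.* + (M ℕ.* S ℕ.* p)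
        ≤⟨ ℤ.*-monoˡ-≤-nonNeg (+ (M ℕ.* K)) le ⟩
      + (M ℕ.* K) ℤ.* (N ℤ.+ + (c ℕ.* S ℕ.* K))
        ≡⟨ cong₂ (λ a b → a ℤ.* (N ℤ.+ b)) (ℤ.pos-* M K) (trans (ℤ.pos-* (c ℕ.* S) K) (cong (ℤ._* + K) (ℤ.pos-* c S))) ⟩
      + M ℤ.* + K ℤ.* (N ℤ.+ + c ℤ.* + S ℤ.* + K)
        ≡⟨ rhs N (+ c) (+ M) (+ K) (+ S) ⟩
      (N ℤ.* + M ℤ.+ + c ℤ.* (+ M ℤ.* + K ℤ.* + S)) ℤ.* + K
        ≡⟨ cong (λ t → (N ℤ.* + M ℤ.+ + c ℤ.* t) ℤ.* + K) (≡-sym MKS) ⟩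
      (N ℤ.* + M ℤ.+ + c ℤ.* + (M ℕ.* K ℕ.* S)) ℤ.* + K ∎))))
    where
    open ℤ.≤-Reasoning
    MKS : + (M ℕ.* K ℕ.* S) ≡ + M ℤ.* + K ℤ.* + S
    MKS = trans (ℤ.pos-* (M ℕ.* K) S) (cong (ℤ._* + S) (ℤ.pos-* M K))
    lhs : ∀ p M K S → p ℤ.* (M ℤ.* K ℤ.* S ℤ.* M) ≡ M ℤ.* K ℤ.* (M ℤ.* S ℤ.* p)
    lhs = solve-∀
    rhs : ∀ N c M K S → M ℤ.* K ℤ.* (N ℤ.+ c ℤ.* S ℤ.* K) ≡ (N ℤ.* M ℤ.+ c ℤ.* (M ℤ.* K ℤ.* S)) ℤ.* K
    rhs = solve-∀

  -- Clearing denominators gives 2 D ≤ n - 2. The result is the condition 2 h ≤ n of the centroid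
  -- bound.
  ≤n/2-1⇒2*suc≤n : ∀ D n → (+ D) / 1 ≤ (+ n) / 2 - (+ 1) / 1 → 2 ℕ.* suc D ℕ.≤ n
  ≤n/2-1⇒2*suc≤n D n le
    with *≤* le′ ← ℚᵘ.≤-respˡ-≃ (toℚᵘ-/ (+ D) 0)
         (ℚᵘ.≤-respʳ-≃ (ℚᵘ.≃-trans (ℚ.toℚᵘ-homo-+ ((+ n) / 2) (- ((+ 1) / 1)))
            (ℚᵘ.+-congˡ (toℚᵘ (- ((+ 1) / 1))) (toℚᵘ-/ (+ n) 1)))
           (ℚ.toℚᵘ-mono-≤ le))
    = ℤ.drop‿+≤+ (begin
      + (2 ℕ.* suc D)               ≡⟨ ℤ.pos-* 2 (suc D) ⟩
      + 2 ℤ.* (+ 1 ℤ.+ + D)          ≡⟨ lhs (+ D) ⟩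
      + D ℤ.* + 2 ℤ.+ + 2            ≤⟨ ℤ.+-monoˡ-≤ (+ 2) le′ ⟩
      (+ n ℤ.* + 1 ℤ.+ -[1+ 0 ] ℤ.* + 2) ℤ.* + 1 ℤ.+ + 2 ≡⟨ rhs (+ n) ⟩
      + n ∎)
    where
    open ℤ.≤-Reasoning
    lhs : ∀ D → + 2 ℤ.* (+ 1 ℤ.+ D) ≡ D ℤ.* + 2 ℤ.+ + 2
    lhs = solve-∀
    rhs : ∀ n → (n ℤ.* + 1 ℤ.+ -[1+ 0 ] ℤ.* + 2) ℤ.* + 1 ℤ.+ + 2 ≡ n
    rhs = solve-∀

  -- Δ ≤ n makes truncated subtraction agree with the integer difference.
  frac-bound-large : ∀ p K S n Δ
    .{{_ : ℕ.NonZero K}} .{{_ : ℕ.NonZero S}} .{{_ : ℕ.NonZero (2 ℕ.* K ℕ.* S)}} → Δ ℕ.≤ n →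
    2 ℕ.* S ℕ.* p ℕ.≤ 3 ℕ.* ((n ℕ.∸ Δ) ℕ.* (n ℕ.∸ Δ)) ℕ.+ 13 ℕ.* S ℕ.* K →
    (+ p) / K ≤ (+ 3 ℤ.* ((+ n ℤ.- + Δ) ℤ.* (+ n ℤ.- + Δ))) / (2 ℕ.* K ℕ.* S) + (+ 13) / 2
  frac-bound-large p K S n Δ Δ≤n le = frac-bound p K S 2 13 (+ 3 ℤ.* ((+ n ℤ.- + Δ) ℤ.* (+ n ℤ.- + Δ)))
    (subst (λ N → + (2 ℕ.* S ℕ.* p) ℤ.≤ N ℤ.+ + (13 ℕ.* S ℕ.* K)) cast (ℤ.+≤+ le))
    where
    n-Δ : + (n ℕ.∸ Δ) ≡ + n ℤ.- + Δ
    n-Δ = ≡-sym (trans (ℤ.m-n≡m⊖n n Δ) (ℤ.⊖-≥ Δ≤n))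
    cast : + (3 ℕ.* ((n ℕ.∸ Δ) ℕ.* (n ℕ.∸ Δ))) ≡ + 3 ℤ.* ((+ n ℤ.- + Δ) ℤ.* (+ n ℤ.- + Δ))
    cast = trans (ℤ.pos-* 3 ((n ℕ.∸ Δ) ℕ.* (n ℕ.∸ Δ))) (cong (+ 3 ℤ.*_) (trans (ℤ.pos-* (n ℕ.∸ Δ) (n ℕ.∸ Δ)) (cong₂ ℤ._*_ n-Δ n-Δ)))

  frac-bound-small : ∀ p K S n Δ
    .{{_ : ℕ.NonZero K}} .{{_ : ℕ.NonZero S}} .{{_ : ℕ.NonZero (4 ℕ.* K ℕ.* S)}} →
    4 ℕ.* S ℕ.* p ℕ.+ 6 ℕ.* (Δ ℕ.* Δ) ℕ.≤ 3 ℕ.* (n ℕ.* n) ℕ.+ 35 ℕ.* S ℕ.* K →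
    (+ p) / K ≤ (+ 3 ℤ.* (+ n ℤ.* + n ℤ.- + 2 ℤ.* (+ Δ ℤ.* + Δ))) / (4 ℕ.* K ℕ.* S) + (+ 35) / 4
  frac-bound-small p K S n Δ le = frac-bound p K S 4 35 (+ 3 ℤ.* (+ n ℤ.* + n ℤ.- + 2 ℤ.* (+ Δ ℤ.* + Δ))) (begin
    + x
      ≡⟨ add-sub (+ x) (+ (6 ℕ.* (Δ ℕ.* Δ))) ⟩
    + (x ℕ.+ 6 ℕ.* (Δ ℕ.* Δ)) ℤ.- + (6 ℕ.* (Δ ℕ.* Δ))
      ≤⟨ ℤ.+-monoˡ-≤ (ℤ.- + (6 ℕ.* (Δ ℕ.* Δ))) (ℤ.+≤+ le) ⟩
    + (3 ℕ.* (n ℕ.* n)) ℤ.+ + t ℤ.- + (6 ℕ.* (Δ ℕ.* Δ))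
      ≡⟨ cong₂ (λ a b → a ℤ.+ + t ℤ.- b) (cast 3 n) (cast 6 Δ) ⟩
    + 3 ℤ.* (+ n ℤ.* + n) ℤ.+ + t ℤ.- + 6 ℤ.* (+ Δ ℤ.* + Δ)
      ≡⟨ regroup (+ n) (+ Δ) (+ t) ⟩
    + 3 ℤ.* (+ n ℤ.* + n ℤ.- + 2 ℤ.* (+ Δ ℤ.* + Δ)) ℤ.+ + t ∎)
    where
    open ℤ.≤-Reasoning
    x = 4 ℕ.* S ℕ.* p
    t = 35 ℕ.* S ℕ.* K
    cast : ∀ a b → + (a ℕ.* (b ℕ.* b)) ≡ + a ℤ.* (+ b ℤ.* + b)
    cast a b = trans (ℤ.pos-* a (b ℕ.* b)) (cong (+ a ℤ.*_) (ℤ.pos-* b b))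
    add-sub : ∀ a b → a ≡ a ℤ.+ b ℤ.- b
    add-sub = solve-∀
    regroup : ∀ n D t → + 3 ℤ.* (n ℤ.* n) ℤ.+ t ℤ.- + 6 ℤ.* (D ℤ.* D)
                      ≡ + 3 ℤ.* (n ℤ.* n ℤ.- + 2 ℤ.* (D ℤ.* D)) ℤ.+ t
    regroup = solve-∀

-- From distance sums to the proximity.

open import Data.Integer as ℤ using (+_)
open import Data.Rational using (ℚ; _/_; _+_; _-_; _<_; _≤_)
open PackingTrees
open Fractions using (frac-bound-large; frac-bound-small; ≤n/2-1⇒2*suc≤n)

theorem3p1 : (k : ℕ) (G : Graph (suc (suc k))) → Connected G →
    (d : Fin (suc (suc k)) → Fin (suc (suc k)) → ℕ) → IsDistance G d →
    (((+ suc (suc k)) / 2 - (+ 1) / 1 < (+ maxDegree G) / 1 →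
        proximity d ≤ (+ 3 ℤ.* ((+ suc (suc k) ℤ.- + maxDegree G) ℤ.* (+ suc (suc k) ℤ.- + maxDegree G))) / (2 Data.Nat.* suc k Data.Nat.* suc (minDegree G))
                      + (+ 13) / 2)
    × ((+ maxDegree G) / 1 ≤ (+ suc (suc k)) / 2 - (+ 1) / 1 →
        proximity d ≤ (+ 3 ℤ.* (+ suc (suc k) ℤ.* + suc (suc k) ℤ.- + 2 ℤ.* (+ maxDegree G ℤ.* + maxDegree G))) / (4 Data.Nat.* suc k Data.Nat.* suc (minDegree G))
                      + (+ 35) / 4))
theorem3p1 k G conn d isD =
    (λ _ → proximity≤ (proj₁ large) (frac-bound-large (∑ (d (proj₁ large)) (allFin n)) K s n Δ Δ≤n (proj₂ large)))
  , (λ Δ≤ → let c , le = small (≤n/2-1⇒2*suc≤n Δ n Δ≤) in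
       proximity≤ c (frac-bound-small (∑ (d c) (allFin n)) K s n Δ le))
  where
  n = suc (suc k)
  K = suc k
  Δ = maxDegree G
  s = suc (minDegree G)

  -- That the order is at least 2 enters here.
  n≤2K : n ℕ.≤ 2 ℕ.* K
  n≤2K = ℕ.s≤s (ℕ.≤-trans (ℕ.≤-reflexive (ℕ.+-comm 1 k)) (ℕ.+-monoʳ-≤ k (ℕ.s≤s ℕ.z≤n)))

  s≤degree : ∀ v → s ℕ.≤ suc (degree G v)
  s≤degree v = ℕ.s≤s (foldr-⊓-≤ (degree G) (degree G zero) (∈-allFin v))

  s≤1+Δ : s ℕ.≤ suc Δ
  s≤1+Δ = ℕ.≤-trans (s≤degree zero) (ℕ.s≤s (∈⇒≤foldr-⊔ (degree G) (∈-allFin {n} zero)))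

  -- `zero ∷ tabulate suc` is `allFin n` with its head exposed.
  maximal = foldr-⊔-attained (degree G) zero (tabulate suc)

  bounds = sum-bounds G conn d isD K s Δ (proj₁ maximal) ℕ.≤-refl n≤2K s≤1+Δ s≤degree (proj₂ maximal)
  Δ≤n    = proj₁ bounds
  large  = proj₁ (proj₂ bounds)
  small  = proj₂ (proj₂ bounds)

  proximity≤ : ∀ c {q} → avgDist d c ≤ q → proximity d ≤ q
  proximity≤ c = ℚ.≤-trans (Fractions.foldr-⊓-≤ (avgDist d) (avgDist d zero) (∈-allFin c))
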